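{- Let $q$ be a prime power, let $d$ be a positive integer, let $k \in \{1,2,\ldots,d-1\}$, and let $E \subset \mathbb{F}_q^d$. If $|E| > 30q^k$, then there is a point $y \in E$ such that $|\pi^y(E)| \geq q^k/4$.
   Context: $\mathbb{F}_q$ denotes the finite field with $q$ elements and $\mathbb{F}_q^d$ the $d$-dimensional vector space over it. A line is an affine line (a translate of a $1$-dimensional linear subspace of $\mathbb{F}_q^d$). For a point $y \in \mathbb{F}_q^d$, the radial projection $\pi^y$ maps each point $x \in \mathbb{F}_q^d \setminus \{y\}$ to the unique line containing $x$ and $y$. For a set $E \subset \mathbb{F}_q^d$, $\pi^y(E)$ denotes the set of lines $\{\pi^y(x) : x \in E \setminus \{y\}\}$, and $|\pi^y(E)|$ is the number of distinct lines in this set (i.e. the number of lines through $y$ that contain at least one point of $E$ other than $y$). -}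

module Defs where

open import Algebra.Bundles using (CommutativeRing)
import Algebra.Properties.Ring as RingProperties
open import Data.Fin.Properties using (≡-setoid)
open import Data.Nat.Base using (ℕ; _≤_; _^_)
open import Data.Nat.Primality using (Prime)
open import Data.Product.Base using (Σ; ∃; ∃₂; _×_; _,_; proj₁)
open import Data.Vec.Functional using (Vector)
import Data.Vec.Functional.Relation.Binary.Equality.Setoid as VecEquality
open import Function.Bundles using (Inverse)
open import Level using (Level; _⊔_; suc)
open import Relation.Binary.Bundles using (Setoid)
import Relation.Binary.Construct.On as On
open import Relation.Binary.PropositionalEquality.Core using (_≡_)
import Relation.Binary.Reasoning.Setoid as SetoidReasoning
open import Relation.Nullary.Negation.Core using (¬_)
open import Relation.Unary using (Pred; _∈_; _≐_)
open import Relation.Unary.Properties using (≐-refl; ≐-sym; ≐-trans)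

private
  variable
    a c ℓ p : Level

IsPrimePower : ℕ → Set
IsPrimePower q = ∃₂ λ r n → Prime r × 1 ≤ n × q ≡ r ^ n

-- Cardinality is taken up to the equality of the setoid.

HasCardinality : Setoid a ℓ → ℕ → Set (a ⊔ ℓ)
HasCardinality S n = Inverse (≡-setoid n) S

subsetoid : (S : Setoid a ℓ) → Pred (Setoid.Carrier S) p → Setoid (a ⊔ p) ℓ
subsetoid S P = On.setoid {B = Σ (Setoid.Carrier S) P} S proj₁

record Field c ℓ : Set (suc (c ⊔ ℓ)) where
  field
    commutativeRing : CommutativeRing c ℓ

  open CommutativeRing commutativeRing public

  field
    1≉0     : 1# ≉ 0#
    inverse : ∀ x → x ≉ 0# → ∃ λ y → x * y ≈ 1#

module Affine (F : Field c ℓ) (d : ℕ) where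

  open Field F
  open VecEquality setoid public using (_≋_; ≋-setoid)

  Point : Set c
  Point = Vector Carrier d

  pointSetoid : Setoid c ℓ
  pointSetoid = ≋-setoid d

  record Line : Set (c ⊔ ℓ) where
    constructor line
    field
      base        : Point
      direction   : Point
      direction≉0 : ¬ (direction ≋ λ _ → 0#)

  points : Line → Pred Point (c ⊔ ℓ)
  points (line b v _) x = ∃ λ t → x ≋ (λ i → b i + t * v i)

  -- Different bases and directions may describe the same line, so lines are
  -- compared as point sets.

  lineSetoid : Setoid (c ⊔ ℓ) (c ⊔ ℓ)
  lineSetoid = record
    { Carrier       = Line
    ; _≈_           = λ L M → points L ≐ points M
    ; isEquivalence = record { refl = ≐-refl ; sym = ≐-sym ; trans = ≐-trans }
    }

  private
    open RingProperties ring using (x∙y⁻¹≈ε⇒x≈y)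
    open SetoidReasoning setoid

    x+[y-x]≈y : ∀ x y → x + (y - x) ≈ y
    x+[y-x]≈y x y = begin
      x + (y - x)   ≈⟨ +-comm x (y - x) ⟩
      (y - x) + x   ≈⟨ +-assoc y (- x) x ⟩
      y + (- x + x) ≈⟨ +-congˡ (-‿inverseˡ x) ⟩
      y + 0#        ≈⟨ +-identityʳ y ⟩
      y             ∎

  -- π y x is the line through x and y; see π-left, π-right and π-unique.

  π : (y x : Point) → ¬ (x ≋ y) → Line
  π y x x≉y = line y (λ i → x i - y i) λ x-y≈0 →
    x≉y λ i → x∙y⁻¹≈ε⇒x≈y (x i) (y i) (x-y≈0 i)

  π-left : ∀ y x (x≉y : ¬ (x ≋ y)) → y ∈ points (π y x x≉y)
  π-left y x _ = 0# , λ i → sym (trans (+-congˡ (zeroˡ _)) (+-identityʳ (y i)))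

  π-right : ∀ y x (x≉y : ¬ (x ≋ y)) → x ∈ points (π y x x≉y)
  π-right y x _ = 1# , λ i →
    sym (trans (+-congˡ (*-identityˡ _)) (x+[y-x]≈y (y i) (x i)))

  π-unique : ∀ y x (x≉y : ¬ (x ≋ y)) L → y ∈ points L → x ∈ points L →
             points L ≐ points (π y x x≉y)
  π-unique y x x≉y (line b v v≉0) (s , y≈) (r , x≈) = to , from
    where
    shift : ∀ t u i → (b i + t * v i) + (u - t) * v i ≈ b i + u * v i
    shift t u i = begin
      (b i + t * v i) + (u - t) * v i ≈⟨ +-assoc _ _ _ ⟩
      b i + (t * v i + (u - t) * v i) ≈⟨ +-congˡ (distribʳ _ _ _) ⟨
      b i + (t + (u - t)) * v i       ≈⟨ +-congˡ (*-congʳ (x+[y-x]≈y t u)) ⟩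
      b i + u * v i                   ∎

    x-y : ∀ i → x i - y i ≈ (r - s) * v i
    x-y i = begin
      x i - y i                       ≈⟨ +-congʳ (trans (x≈ i) (sym (shift s r i))) ⟩
      ((b i + s * v i) + (r - s) * v i) - y i ≈⟨ +-congʳ (+-congʳ (y≈ i)) ⟨
      (y i + (r - s) * v i) - y i     ≈⟨ +-assoc _ _ _ ⟩
      y i + ((r - s) * v i - y i)     ≈⟨ x+[y-x]≈y _ _ ⟩
      (r - s) * v i                   ∎

    r-s≉0 : r - s ≉ 0#
    r-s≉0 r-s≈0 = x≉y λ i →
      x∙y⁻¹≈ε⇒x≈y (x i) (y i)
        (trans (x-y i) (trans (*-congʳ r-s≈0) (zeroˡ _)))

    to : ∀ {z} → z ∈ points (line b v v≉0) → z ∈ points (π y x x≉y)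
    to {z} (t , z≈) with inverse (r - s) r-s≉0
    ... | e , inv = (t - s) * e , λ i → begin
      z i                                     ≈⟨ z≈ i ⟩
      b i + t * v i                           ≈⟨ shift s t i ⟨
      (b i + s * v i) + (t - s) * v i         ≈⟨ +-congʳ (y≈ i) ⟨
      y i + (t - s) * v i                     ≈⟨ +-congˡ (*-congʳ (*-identityʳ _)) ⟨
      y i + ((t - s) * 1#) * v i              ≈⟨ +-congˡ (*-congʳ (*-congˡ (trans (*-comm e _) inv))) ⟨
      y i + ((t - s) * (e * (r - s))) * v i   ≈⟨ +-congˡ (*-congʳ (*-assoc _ _ _)) ⟨
      y i + (((t - s) * e) * (r - s)) * v i   ≈⟨ +-congˡ (*-assoc _ _ _) ⟩
      y i + ((t - s) * e) * ((r - s) * v i)   ≈⟨ +-congˡ (*-congˡ (x-y i)) ⟨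
      y i + ((t - s) * e) * (x i - y i)       ∎

    from : ∀ {z} → z ∈ points (π y x x≉y) → z ∈ points (line b v v≉0)
    from {z} (t , z≈) = s + t * (r - s) , λ i → begin
      z i                                     ≈⟨ z≈ i ⟩
      y i + t * (x i - y i)                   ≈⟨ +-cong (y≈ i) (*-congˡ (x-y i)) ⟩
      (b i + s * v i) + t * ((r - s) * v i)   ≈⟨ +-congˡ (*-assoc _ _ _) ⟨
      (b i + s * v i) + (t * (r - s)) * v i   ≈⟨ +-assoc _ _ _ ⟩
      b i + (s * v i + (t * (r - s)) * v i)   ≈⟨ +-congˡ (distribʳ _ _ _) ⟨
      b i + (s + t * (r - s)) * v i           ∎

  π[_] : Point → Pred Point p → Pred Line (c ⊔ ℓ ⊔ p)
  π[ y ] E L = ∃ λ x → x ∈ E × Σ (¬ (x ≋ y)) λ x≉y →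
    points L ≐ points (π y x x≉y)

{-# OPTIONS --safe #-}

-- Average over all k × d matrices M.  At most q ^ k points of E are alone in
-- their fibre of M, whereas any other y ∈ E lies on a line of π[ y ] E whose
-- direction is killed by M.  A given direction is killed by a proportion
-- q ^ - k of all matrices, so if every π[ y ] E had fewer than q ^ k / 4 lines,
-- few pairs (y , M) would be of the second kind and E would be small.
-- Both estimates are packed into one injection, defined on triples (y , t , M)
-- with t ∈ F ^ k: it sends (y , t , M) to (y , ℓ , M + t ⊗ e_c) if M kills the
-- direction of a line ℓ ∈ π[ y ] E whose c-th coordinate is nonzero, and to
-- (M y , t , M) if y is alone in its fibre.

module Submission where

open import Defs
import Algebra.Properties.AbelianGroup as AbelianGroupProperties
import Algebra.Properties.CommutativeMonoid.Sum as Sum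
import Algebra.Properties.Semiring.Sum as SemiringSum
open import Data.Fin.Base using (Fin; combine; zero; suc; finToFun; funToFin; inject≤)
open import Data.Fin.Properties as Fin
  using (≡-setoid; any?; ¬∀⟶∃¬; injective⇒≤; inject≤-injective;
         *↔×; +↔⊎; finToFun-funToFin; funToFin-finToFin)
open import Data.List.Base using (List; _∷_; length; lookup; mapMaybe; allFin; deduplicate)
open import Data.List.Membership.Propositional.Properties using (∈-allFin; ∈-lookup)
import Data.List.Relation.Unary.All as All
open import Data.List.Relation.Unary.AllPairs using (_∷_)
open import Data.List.Relation.Unary.Any as ListAny using (index)
open import Data.List.Relation.Unary.Any.Properties as AnyProperties using (lookup-index; mapMaybe⁺)
import Data.List.Relation.Unary.Enumerates.Setoid as Enumerates
import Data.List.Relation.Unary.Enumerates.Setoid.Properties as EnumeratesProperties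
import Data.List.Relation.Unary.Unique.DecSetoid.Properties as UniqueDec
import Data.List.Relation.Unary.Unique.Setoid as Unique
open import Data.Maybe.Base using (Maybe; just; nothing)
import Data.Maybe.Relation.Unary.Any as MaybeAny
open import Data.Nat.Base as ℕ using (ℕ; _≤_; _>_; _^_; _∸_)
open import Data.Nat.DivMod using (m/n*n≤m; /-monoˡ-≤; m*n/n≡m)
import Data.Nat.Properties as ℕ
open import Data.Nat.Solver using (module +-*-Solver)
open import Data.Product.Base using (∃; _×_; _,_; proj₁; proj₂)
open import Data.Product.Function.NonDependent.Setoid using (_×-inverse_)
open import Data.Product.Relation.Binary.Pointwise.NonDependent as × using (_×ₛ_)
open import Data.Sum.Base using (inj₁; inj₂)
open import Data.Sum.Function.Setoid using (_⊎-inverse_)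
open import Data.Sum.Relation.Binary.Pointwise as ⊎ using (_⊎ₛ_; inj₁; inj₂)
open import Data.Vec.Functional using (Vector; updateAt)
open import Data.Vec.Functional.Properties using (updateAt-updates; updateAt-minimal)
import Data.Vec.Functional.Relation.Binary.Equality.Setoid as VecEquality
open import Function.Base using (_∘_)
open import Function.Bundles using (Inverse; Injection)
import Function.Construct.Composition as Compose
import Function.Construct.Identity as Identity
import Function.Construct.Symmetry as Symmetry
open import Function.Properties.Inverse using (Inverse⇒Injection)
open import Level using (Level; _⊔_)
open import Relation.Binary.Bundles using (Setoid; DecSetoid)
open import Relation.Binary.Definitions using (_Respects_) renaming (Decidable to Decidable₂)
open import Relation.Binary.PropositionalEquality as ≡ using (_≡_; refl)
import Relation.Binary.Reasoning.Setoid as SetoidReasoning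
open import Relation.Nullary.Decidable using (Dec; yes; no; map′; ¬?; _×-dec_; decidable-stable; via-injection)
open import Relation.Nullary.Negation using (¬_; contradiction)
open import Relation.Unary using (Pred; Decidable; _∈_; _≐_)
open import Relation.Unary.Properties using (≐-refl; ≐-sym; ≐-trans)

-- Cardinalities of products, sums and vectors.

private
  variable
    a b ℓ₁ ℓ₂ : Level
    S : Setoid a ℓ₁
    T : Setoid b ℓ₂
    m n : ℕ

×-cardinality : HasCardinality S m → HasCardinality T n → HasCardinality (S ×ₛ T) (m ℕ.* n)
×-cardinality hS hT =
  Compose.inverse *↔× (Compose.inverse (Symmetry.inverse ×.Pointwise-≡↔≡) (hS ×-inverse hT))

⊎-cardinality : HasCardinality S m → HasCardinality T n → HasCardinality (S ⊎ₛ T) (m ℕ.+ n)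
⊎-cardinality hS hT =
  Compose.inverse +↔⊎ (Compose.inverse (Symmetry.inverse (⊎.Pointwise-≡↔≡ _ _)) (hS ⊎-inverse hT))

funToFin-cong : {f g : Fin m → Fin n} → (∀ i → f i ≡ g i) → funToFin f ≡ funToFin g
funToFin-cong {m = ℕ.zero}  _   = refl
funToFin-cong {m = ℕ.suc _} f≗g = ≡.cong₂ Data.Fin.Base.combine (f≗g zero) (funToFin-cong (f≗g ∘ suc))

-- A code below `m ^ n` is read as its `n` digits in base `m`, each digit naming an element of `S`.
vector-cardinality : HasCardinality S m → ∀ n → HasCardinality (VecEquality.≋-setoid S n) (m ^ n)
vector-cardinality {S = S} {m = m} hS n = record
  { to        = λ c i → to (finToFun c i)
  ; from      = λ v → funToFin (λ i → from (v i))
  ; to-cong   = λ where refl i → S.refl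
  ; from-cong = λ v≋w → funToFin-cong (λ i → from-cong (v≋w i))
  ; inverse   =
      (λ where refl i → inverseˡ (finToFun-funToFin _ i)) ,
      (λ {c} v≋ → ≡.trans (funToFin-cong (λ i → inverseʳ (v≋ i))) (funToFin-finToFin {n} {m} c))
  }
  where
  open Inverse hS
  module S = Setoid S

module _ {S : Setoid a ℓ₁} (hS : HasCardinality S m) where
  open Setoid S using (_≈_)

  finite⇒decidable : Decidable₂ _≈_
  finite⇒decidable =
    via-injection (Inverse⇒Injection (Symmetry.inverse hS)) Fin._≟_

  cardinality-injective : {T : Setoid b ℓ₂} → HasCardinality T n →
    (f : Setoid.Carrier S → Setoid.Carrier T) →
    (∀ {x y} → Setoid._≈_ T (f x) (f y) → x ≈ y) → m ≤ n
  cardinality-injective hT f f-injective = injective⇒≤ {f = T.to ∘ f ∘ S.to} λ eq →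
    S.injective (f-injective (T.injective eq))
    where
    module S = Injection (Inverse⇒Injection hS)
    module T = Injection (Inverse⇒Injection (Symmetry.inverse hT))

  inhabited⇒nonZero : Setoid.Carrier S → ℕ.NonZero m
  inhabited⇒nonZero x = Fin.nonZeroIndex (Inverse.from hS x)

-- Finiteness from an enumeration with repetitions.

module _ (S : DecSetoid a ℓ₁) where
  open DecSetoid S using (_≈_; _≟_; setoid) renaming (Carrier to A; refl to ≈-refl; sym to ≈-sym; trans to ≈-trans)
  open Unique setoid using (Unique)
  open Enumerates setoid using (IsEnumeration)

  lookup-injective : ∀ {xs : List A} → Unique xs → ∀ i j → lookup xs i ≈ lookup xs j → i ≡ j
  lookup-injective {_ ∷ _}  _            zero    zero    _   = refl
  lookup-injective {_ ∷ xs} (x≉xs ∷ _)   zero    (suc j) x≈y =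
    contradiction x≈y (All.lookup x≉xs (∈-lookup {xs = xs} j))
  lookup-injective {_ ∷ xs} (x≉xs ∷ _)   (suc i) zero    y≈x =
    contradiction (≈-sym y≈x) (All.lookup x≉xs (∈-lookup {xs = xs} i))
  lookup-injective {_ ∷ _}  (_ ∷ unique) (suc i) (suc j) x≈y =
    ≡.cong suc (lookup-injective unique i j x≈y)

  -- Deduplication leaves one representative of each class, so the position in the shortened list is
  -- a bijection.
  enumerated⇒finite : ∀ {xs} → IsEnumeration xs → ∃ (HasCardinality setoid)
  enumerated⇒finite {xs} _∈xs = length ys , record
    { to        = lookup ys
    ; from      = λ x → index (x ∈ys)
    ; to-cong   = λ where refl → ≈-refl
    ; from-cong = λ x≈y → lookup-index-injective
        (≈-trans (≈-sym (lookup-index (_ ∈ys))) (≈-trans x≈y (lookup-index (_ ∈ys))))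
    ; inverse   = (λ where refl → ≈-sym (lookup-index (_ ∈ys))) ,
                  (λ x≈ → lookup-index-injective (≈-trans (≈-sym (lookup-index (_ ∈ys))) x≈))
    }
    where
    ys : List A
    ys = deduplicate _≟_ xs

    _∈ys : IsEnumeration ys
    _∈ys = EnumeratesProperties.deduplicate⁺ S _∈xs

    lookup-index-injective : ∀ {i j} → lookup ys i ≈ lookup ys j → i ≡ j
    lookup-index-injective = lookup-injective (UniqueDec.deduplicate-! S xs) _ _

-- Linear forms over a field and changes of one coefficient.

module _ {c ℓ : Level} (F : Field c ℓ) where
  open Field F hiding (zero) renaming (refl to ≈-refl)
  open Sum +-commutativeMonoid using (sum; sum-cong-≋; ∑-distrib-+)
  open SemiringSum semiring using (*-distribˡ-sum)
  open AbelianGroupProperties +-abelianGroup using (∙-cancelˡ; ∙-cancelʳ)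
  open VecEquality setoid using (_≋_; ≋-setoid)
  open SetoidReasoning setoid

  private
    variable
      u v x y : Vector Carrier n
      s t : Carrier

    *-swap : ∀ x y z → x * (y * z) ≈ y * (x * z)
    *-swap x y z = trans (sym (*-assoc x y z)) (trans (*-congʳ (*-comm x y)) (*-assoc y x z))

  *-cancelʳ-≉0 : ∀ {x y z} → z ≉ 0# → x * z ≈ y * z → x ≈ y
  *-cancelʳ-≉0 {x} {y} {z} z≉0 xz≈yz with w , zw≈1 ← inverse z z≉0 = begin
    x           ≈⟨ unit x ⟨
    x * z * w   ≈⟨ *-congʳ xz≈yz ⟩
    y * z * w   ≈⟨ unit y ⟩
    y           ∎
    where
    unit : ∀ x → x * z * w ≈ x
    unit x = trans (*-assoc x z w) (trans (*-congˡ zw≈1) (*-identityʳ x))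

  dot : Vector Carrier n → Vector Carrier n → Carrier
  dot u x = sum (λ i → u i * x i)

  dot-cong : u ≋ v → x ≋ y → dot u x ≈ dot v y
  dot-cong u≋v x≋y = sum-cong-≋ (λ i → *-cong (u≋v i) (x≋y i))

  dot-scale : ∀ (u : Vector Carrier n) t x → dot u (λ i → t * x i) ≈ t * dot u x
  dot-scale u t x = trans (sum-cong-≋ (λ i → *-swap (u i) t (x i))) (sym (*-distribˡ-sum t (λ i → u i * x i)))

  dot-difference : (u x y : Vector Carrier n) → dot u x ≈ dot u y → dot u (λ i → x i - y i) ≈ 0#
  -- Adding `dot u y` to both sides reduces the claim to additivity of `dot u`, with no negation
  -- carried through the sum.
  dot-difference u x y ux≈uy = ∙-cancelʳ (dot u y) _ _ (begin
    dot u (λ i → x i - y i) + dot u y           ≈⟨ ∑-distrib-+ _ (λ i → u i * y i) ⟨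
    sum (λ i → u i * (x i - y i) + u i * y i)   ≈⟨ sum-cong-≋ (λ i → x-y+y (u i) (x i) (y i)) ⟩
    dot u x                                     ≈⟨ ux≈uy ⟩
    dot u y                                     ≈⟨ +-identityˡ _ ⟨
    0# + dot u y                                ∎)
    where
    x-y+y : ∀ u x y → u * (x - y) + u * y ≈ u * x
    x-y+y u x y = begin
      u * (x - y) + u * y   ≈⟨ distribˡ u (x - y) y ⟨
      u * (x - y + y)       ≈⟨ *-congˡ (+-assoc x (- y) y) ⟩
      u * (x + (- y + y))   ≈⟨ *-congˡ (+-congˡ (-‿inverseˡ y)) ⟩
      u * (x + 0#)          ≈⟨ *-congˡ (+-identityʳ x) ⟩
      u * x                 ∎

  dot-updateAt : ∀ (u x : Vector Carrier n) i t →
                 dot (updateAt u i (t +_)) x ≈ t * x i + dot u x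
  dot-updateAt u x zero t = trans (+-congʳ (distribʳ _ _ _)) (+-assoc _ _ _)
  dot-updateAt {n = ℕ.suc n} u x (suc i) t = begin
    u₀x₀ + dot (updateAt u′ i (t +_)) x′     ≈⟨ +-congˡ (dot-updateAt u′ x′ i t) ⟩
    u₀x₀ + (t * x′ i + dot u′ x′)            ≈⟨ +-assoc _ _ _ ⟨
    (u₀x₀ + t * x′ i) + dot u′ x′            ≈⟨ +-congʳ (+-comm _ _) ⟩
    (t * x′ i + u₀x₀) + dot u′ x′            ≈⟨ +-assoc _ _ _ ⟩
    t * x′ i + (u₀x₀ + dot u′ x′)            ∎
    where
    u₀x₀ = u zero * x zero
    u′   = u ∘ suc
    x′   = x ∘ suc

  updateAt-cancel : ∀ (i : Fin n) → s ≈ t →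
    updateAt u i (s +_) ≋ updateAt v i (t +_) → u ≋ v
  updateAt-cancel {s = s} {t} {u = u} {v} i s≈t eq j with i Fin.≟ j
  ... | yes refl = ∙-cancelˡ s _ _ (begin
    s + u i                   ≡⟨ updateAt-updates i u ⟨
    updateAt u i (s +_) i     ≈⟨ eq i ⟩
    updateAt v i (t +_) i     ≡⟨ updateAt-updates i v ⟩
    t + v i                   ≈⟨ +-congʳ s≈t ⟨
    s + v i                   ∎)
  ... | no i≢j = begin
    u j                       ≡⟨ updateAt-minimal j i u (i≢j ∘ ≡.sym) ⟨
    updateAt u i (s +_) j     ≈⟨ eq j ⟩
    updateAt v i (t +_) j     ≡⟨ updateAt-minimal j i v (i≢j ∘ ≡.sym) ⟩
    v j                       ∎

  -- On forms that kill x, the summand t * x i of the updated form determines t.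
  updateAt-injective : ∀ (i : Fin n) → x i ≉ 0# → dot u x ≈ 0# → dot v x ≈ 0# →
    updateAt u i (s +_) ≋ updateAt v i (t +_) → s ≈ t × u ≋ v
  updateAt-injective {x = x} {u = u} {v = v} {s = s} {t = t} i xᵢ≉0 ux≈0 vx≈0 eq =
    s≈t , updateAt-cancel i s≈t eq
    where
    value : ∀ w r → dot w x ≈ 0# → dot (updateAt w i (r +_)) x ≈ r * x i
    value w r wx≈0 = begin
      dot (updateAt w i (r +_)) x   ≈⟨ dot-updateAt w x i r ⟩
      r * x i + dot w x             ≈⟨ +-congˡ wx≈0 ⟩
      r * x i + 0#                  ≈⟨ +-identityʳ _ ⟩
      r * x i                       ∎

    s≈t : s ≈ t
    s≈t = *-cancelʳ-≉0 xᵢ≉0 (begin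
      s * x i                       ≈⟨ value u s ux≈0 ⟨
      dot (updateAt u i (s +_)) x   ≈⟨ dot-cong eq (λ _ → ≈-refl) ⟩
      dot (updateAt v i (t +_)) x   ≈⟨ value v t vx≈0 ⟩
      t * x i                       ∎)

-- Matrices and decidable incidence over a finite field.

module _ {c ℓ : Level} {q : ℕ} (F : Field c ℓ) (hF : HasCardinality (Field.setoid F) q) (d k : ℕ) where
  open Field F hiding (zero) renaming (refl to ≈-refl)
  open Affine F d
  open VecEquality setoid using (≋-sym; ≋-trans)
  open AbelianGroupProperties +-abelianGroup using (x∙y⁻¹≈ε⇒x≈y; xyx⁻¹≈y)

  private
    _≟_ : Decidable₂ _≈_
    _≟_ = finite⇒decidable hF

    point-cardinality : ∀ n → HasCardinality (≋-setoid n) (q ^ n)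
    point-cardinality = vector-cardinality hF

    matrixSetoid : Setoid c ℓ
    matrixSetoid = VecEquality.≋-setoid pointSetoid k

    Matrix : Set c
    Matrix = Setoid.Carrier matrixSetoid

    matrix-cardinality : HasCardinality matrixSetoid ((q ^ d) ^ k)
    matrix-cardinality = vector-cardinality (point-cardinality d) k

    _≟ᵖ_ : ∀ {n} → Decidable₂ (_≋_ {n = n})
    _≟ᵖ_ {n} = finite⇒decidable (point-cardinality n)

  apply : Matrix → Point → Vector Carrier k
  apply M x r = dot F (M r) x

  points-resp : ∀ L {x y} → x ≋ y → x ∈ points L → y ∈ points L
  points-resp (line _ _ _) x≋y (t , x≈) = t , ≋-trans (≋-sym x≋y) x≈

  points? : ∀ L → Decidable (points L)
  points? (line b v _) x = map′
    (λ (i , eq) → to i , eq)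
    -- The search runs over codes of scalars, so `t` is replaced by its representative
    -- `to (from t)`.
    (λ (t , eq) → from t , λ i →
      trans (eq i) (+-congˡ (*-congʳ (sym (inverseˡ refl)))))
    (any? λ i → x ≟ᵖ λ j → b j + to i * v j)
    where open Inverse hF

  -- Lines through a point that meet the set elsewhere.

  module _ {p : Level} (E : Pred Point p) (m : ℕ) (hE : HasCardinality (subsetoid pointSetoid E) m) where
    private
      module E = Inverse hE

      e : Fin m → Point
      e i = proj₁ (E.to i)

    π[_]-setoid : Point → Setoid (c ⊔ ℓ ⊔ p) (c ⊔ ℓ)
    π[ y ]-setoid = subsetoid lineSetoid (π[ y ] E)

    module _ (y : Point) where
      open Setoid π[ y ]-setoid using () renaming (Carrier to Lines; _≈_ to _≈ᴸ_)

      line-through : ∀ {x} → x ∈ E → ¬ (x ≋ y) → Lines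
      line-through {x} x∈E x≉y = π y x x≉y , x , x∈E , x≉y , ≐-refl

      -- Both lines pass through `y`, so by `π-unique` they coincide as soon as the first contains
      -- the witness `x` of the second: one incidence test decides equality.
      _≟ᴸ_ : Decidable₂ _≈ᴸ_
      (L , w , _ , w≉y , L≐) ≟ᴸ (M , x , _ , x≉y , M≐) = map′
        (λ x∈L → ≐-trans (π-unique y x x≉y L (proj₂ L≐ (π-left y w w≉y)) x∈L) (≐-sym M≐))
        (λ L≐M → proj₂ L≐M (proj₂ M≐ (π-right y x x≉y)))
        (points? L x)

      private
        candidate : Fin m → Maybe Lines
        candidate i with e i ≟ᵖ y
        ... | yes _  = nothing
        ... | no i≉y = just (line-through (proj₂ (E.to i)) i≉y)

        candidate-complete : ∀ (L : Lines) → ∃ λ i → MaybeAny.Any (L ≈ᴸ_) (candidate i)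
        candidate-complete (L , x , x∈E , x≉y , L≐) = i , found
          where
          i : Fin m
          i = E.from (x , x∈E)

          eᵢ≋x : e i ≋ x
          eᵢ≋x = E.inverseˡ refl

          found : MaybeAny.Any ((L , x , x∈E , x≉y , L≐) ≈ᴸ_) (candidate i)
          found with e i ≟ᵖ y
          ... | yes i≋y = contradiction (≋-trans (≋-sym eᵢ≋x) i≋y) x≉y
          ... | no  i≉y = MaybeAny.just (π-unique y (e i) i≉y L
            (proj₂ L≐ (π-left y x x≉y))
            (points-resp L (≋-sym eᵢ≋x) (proj₂ L≐ (π-right y x x≉y))))

      abstract
        -- Running through the points of `E` other than `y` meets every line, possibly several
        -- times. The proof is kept opaque because later arguments use only the number of lines and
        -- the bijection.
        π[_]-finite : ∃ (HasCardinality π[ y ]-setoid)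
        π[_]-finite = enumerated⇒finite decSetoid {xs = mapMaybe candidate (allFin m)} λ L →
          let i , found = candidate-complete L in
          mapMaybe⁺ candidate (allFin m)
            (AnyProperties.map⁺ (ListAny.map (λ where refl → found) (∈-allFin i)))
          where
          decSetoid : DecSetoid (c ⊔ ℓ ⊔ p) (c ⊔ ℓ)
          decSetoid = record
            { isDecEquivalence = record
              { isEquivalence = Setoid.isEquivalence π[ y ]-setoid ; _≟_ = _≟ᴸ_ } }

      module _ (L : Lines) where
        private
          x = proj₁ (proj₂ L)
          x≉y = proj₁ (proj₂ (proj₂ (proj₂ L)))

        -- This depends on the witness stored in `L`, not only on `L` as a point set. The shears
        -- below therefore use the fixed representatives `Lines.to i l`.
        direction : Point
        direction i = x i - y i

        -- Supplies the coordinate c at which matrices are changed: the witness differs from `y`,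
        -- and over finitely many coordinates with decidable equality a differing one can be found.
        direction-pivot : ∃ λ i → direction i ≉ 0#
        direction-pivot with i , xᵢ≉yᵢ ← ¬∀⟶∃¬ d _ (λ i → x i ≟ y i) x≉y =
          i , λ eq → xᵢ≉yᵢ (x∙y⁻¹≈ε⇒x≈y _ _ eq)

      -- The witness `x′` of `L` lies on the line through `y` and `x`, so `direction L` is a
      -- multiple of `x - y`, which `M` kills by linearity.
      direction-killed : ∀ {x} (x∈E : x ∈ E) (x≉y : ¬ (x ≋ y)) L → L ≈ᴸ line-through x∈E x≉y →
        ∀ M → apply M x ≋ apply M y → apply M (direction L) ≋ λ _ → 0#
      direction-killed {x} x∈E x≉y (L , x′ , _ , x′≉y , L≐) L≐x M Mx≋My r
        with t , x′≈ ← proj₁ L≐x (proj₂ L≐ (π-right y x′ x′≉y)) = begin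
        dot F (M r) (λ i → x′ i - y i)         ≈⟨ dot-cong F (λ _ → ≈-refl) (λ i →
                                                  trans (+-congʳ (x′≈ i)) (xyx⁻¹≈y (y i) _)) ⟩
        dot F (M r) (λ i → t * (x i - y i))    ≈⟨ dot-scale F (M r) t _ ⟩
        t * dot F (M r) (λ i → x i - y i)      ≈⟨ *-congˡ (dot-difference F (M r) x y (Mx≋My r)) ⟩
        t * 0#                                 ≈⟨ zeroʳ t ⟩
        0#                                     ∎
        where open SetoidReasoning setoid

    lineCount : Fin m → ℕ
    lineCount i = proj₁ (π[ e i ]-finite)

    -- The injection on triples and the resulting inequality.

    module _ (N : ℕ) (lineCount≤N : ∀ i → lineCount i ≤ N) where
      private
        module Lines i = Inverse (proj₂ (π[ e i ]-finite))

        -- The left summand of `Target` receives the points with a collision, each with `N` slots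
        -- for its lines; the right summand receives the points alone in their fibre. The common
        -- matrix factor cancels in the count.
        Source Target : Setoid _ _
        Source = (≡-setoid m ×ₛ ≋-setoid k) ×ₛ matrixSetoid
        Target = ((≡-setoid m ×ₛ ≡-setoid N) ⊎ₛ (≋-setoid k ×ₛ ≋-setoid k)) ×ₛ matrixSetoid

        open Setoid Source using () renaming (_≈_ to _≈ˢ_)
        open Setoid Target using () renaming (_≈_ to _≈ᵗ_)

        source-cardinality : HasCardinality Source ((m ℕ.* q ^ k) ℕ.* (q ^ d) ^ k)
        source-cardinality =
          ×-cardinality (×-cardinality (Identity.inverse _) (point-cardinality k)) matrix-cardinality

        target-cardinality :
          HasCardinality Target ((m ℕ.* N ℕ.+ q ^ k ℕ.* q ^ k) ℕ.* (q ^ d) ^ k)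
        target-cardinality = ×-cardinality
          (⊎-cardinality (×-cardinality (Identity.inverse _) (Identity.inverse _))
                         (×-cardinality (point-cardinality k) (point-cardinality k)))
          matrix-cardinality

        Collision : Fin m → Matrix → Set ℓ
        Collision i M = ∃ λ j → ¬ (e j ≋ e i) × apply M (e j) ≋ apply M (e i)

        collision? : ∀ i M → Dec (Collision i M)
        collision? i M = any? λ j → ¬? (e j ≟ᵖ e i) ×-dec (apply M (e j) ≟ᵖ apply M (e i))

        -- This is `M + t ⊗ e_c`, with c the pivot. If `M` kills the direction v, the sheared matrix
        -- sends v to `t` scaled by the nonzero entry v_c, so `t` can be recovered.
        shear : ∀ i → Fin (lineCount i) → Vector Carrier k → Matrix → Matrix
        shear i l t M r = updateAt (M r) (proj₁ (direction-pivot (e i) (Lines.to i l))) (t r +_)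

        Killed : ∀ i → Fin (lineCount i) → Matrix → Set ℓ
        Killed i l M = apply M (direction (e i) (Lines.to i l)) ≋ λ _ → 0#

        killedLine : ∀ i M → Collision i M → ∃ λ l → Killed i l M
        killedLine i M (j , j≉i , Mj≋Mi) =
          -- `Lines.to i l` equals the line through the two colliding points only as a point set,
          -- which is all that `direction-killed` asks for.
          l , direction-killed (e i) eⱼ∈E j≉i (Lines.to i l) (Lines.inverseˡ i refl) M Mj≋Mi
          where
          eⱼ∈E = proj₂ (E.to j)
          l    = Lines.from i (line-through (e i) eⱼ∈E j≉i)

        -- The decision is an explicit argument so that `encode-injective` can split on it for both
        -- triples.
        encode : ∀ i t M → Dec (Collision i M) → Setoid.Carrier Target
        encode i t M (yes collision) = inj₁ (i , inject≤ l (lineCount≤N i)) , shear i l t M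
          where l = proj₁ (killedLine i M collision)
        encode i t M (no _) = inj₂ (apply M (e i) , t) , M

        -- Equal line indices give the same pivot and the same killed direction, so
        -- `updateAt-injective` applies to each row.
        shear-injective : ∀ i {l l′ t t′ M M′} → Killed i l M → Killed i l′ M′ → l ≡ l′ →
          (∀ r → shear i l t M r ≋ shear i l′ t′ M′ r) → t ≋ t′ × (∀ r → M r ≋ M′ r)
        shear-injective i {l} killed killed′ refl eq =
          (λ r → proj₁ (rows r)) , (λ r → proj₂ (rows r))
          where
          pivot = direction-pivot (e i) (Lines.to i l)
          rows = λ r → updateAt-injective F (proj₁ pivot) (proj₂ pivot) (killed r) (killed′ r) (eq r)

        encode-injective : ∀ {i i′ t t′ M M′} D D′ →
          encode i t M D ≈ᵗ encode i′ t′ M′ D′ → ((i , t) , M) ≈ˢ ((i′ , t′) , M′)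
        encode-injective {i} {M = M} {M′} (yes D) (yes D′) (inj₁ (refl , l≡) , eq) =
          let l  , killed  = killedLine i M D
              l′ , killed′ = killedLine i M′ D′
              t≋t′ , M≋M′  = shear-injective i killed killed′ (inject≤-injective _ _ l l′ l≡) eq
          in (refl , t≋t′) , M≋M′
        encode-injective (yes D) (no _) (() , _)
        encode-injective (no _) (yes D) (() , _)
        encode-injective {i} {i′} {M = M} {M′} (no alone) (no _) (inj₂ (Mi≋M′i′ , t≋t′) , M≋M′) =
          (≡.sym (Injection.injective (Inverse⇒Injection hE) eᵢ′≋eᵢ) , t≋t′) , M≋M′
          where
          eᵢ′≋eᵢ : e i′ ≋ e i
          -- The two matrices agree, so `e i′` and `e i` have the same image under `M`; were they
          -- distinct, they would form a collision at `i`.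
          eᵢ′≋eᵢ = decidable-stable (e i′ ≟ᵖ e i) λ i′≉i → alone (i′ , i′≉i ,
            λ r → trans (dot-cong F (M≋M′ r) (λ _ → ≈-refl)) (sym (Mi≋M′i′ r)))

      -- The cardinalities of `Source` and `Target` are compared along `encode`, and the number of
      -- matrices, nonzero because of the zero matrix, is cancelled.
      collision-count : m ℕ.* q ^ k ≤ m ℕ.* N ℕ.+ q ^ k ℕ.* q ^ k
      collision-count = ℕ.*-cancelʳ-≤ _ _ _ {{inhabited⇒nonZero matrix-cardinality λ _ _ → 0#}}
        (cardinality-injective source-cardinality target-cardinality
          (λ ((i , t) , M) → encode i t M (collision? i M))
          (λ {x} {y} → encode-injective (collision? _ _) (collision? _ _)))

-- Arithmetic and the choice of the point.

open import Data.Nat.Base using (_*_; _+_; _/_)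

-- Doubling the last hypothesis bounds `2mP` by `m(2N) + 2P²`, hence by `mP + 2P²`; then `mP` and a
-- factor `P` cancel.
linear-bound : ∀ m N P .{{_ : ℕ.NonZero P}} → N * 2 ≤ P → m * P ≤ m * N + P * P → m ≤ P * 2
linear-bound m N P 2N≤P mP≤ = ℕ.*-cancelʳ-≤ m (P * 2) P (ℕ.+-cancelˡ-≤ (m * P) _ _ (begin
  m * P + m * P                       ≤⟨ ℕ.+-mono-≤ mP≤ mP≤ ⟩
  (m * N + P * P) + (m * N + P * P)   ≡⟨ solve 3 (λ m N P →
      (m :* N :+ P :* P) :+ (m :* N :+ P :* P) := m :* (N :* con 2) :+ P :* con 2 :* P) refl m N P ⟩
  m * (N * 2) + P * 2 * P             ≤⟨ ℕ.+-monoˡ-≤ _ (ℕ.*-monoʳ-≤ m 2N≤P) ⟩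
  m * P + P * 2 * P                   ∎))
  where
  open ℕ.≤-Reasoning
  open +-*-Solver

theorem1p3 : ∀ {c ℓ p} (q d k : ℕ) (F : Field c ℓ) →
    let open Affine F d in
    IsPrimePower q → HasCardinality (Field.setoid F) q →
    1 ≤ d → 1 ≤ k → k ≤ d ∸ 1 →
    (E : Pred Point p) → E Respects _≋_ →
    (m : ℕ) → HasCardinality (subsetoid pointSetoid E) m →
    m > 30 * q ^ k →
    ∃ λ (y : Point) → y ∈ E ×
    ∃ λ (n : ℕ) → HasCardinality (subsetoid lineSetoid (π[ y ] E)) n ×
    q ^ k ≤ 4 * n
theorem1p3 q d k F _ hF _ _ _ E _ m hE m>30qᵏ
  with any? (λ i → q ^ k ℕ.≤? 4 * lineCount F hF d k E m hE i)
... | yes (i , large) =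
  let y , y∈E = Inverse.to hE i
      n , hn  = π[_]-finite F hF d k E m hE y
  in y , y∈E , n , hn , large
-- If every point of `E` had fewer than `q ^ k / 4` lines, the count would give `m ≤ 2 * q ^ k`,
-- well below the assumed size.
... | no allSmall = contradiction m>30qᵏ (ℕ.≤⇒≯ (begin
  m              ≤⟨ linear-bound m N (q ^ k) {{qᵏ≢0}} 2N≤qᵏ
                      (collision-count F hF d k E m hE N lineCount≤N) ⟩
  q ^ k * 2      ≤⟨ ℕ.*-monoʳ-≤ (q ^ k) (ℕ.m≤m+n 2 28) ⟩
  q ^ k * 30     ≡⟨ ℕ.*-comm (q ^ k) 30 ⟩
  30 * q ^ k     ∎))
  where
  open ℕ.≤-Reasoning

  N : ℕ
  N = q ^ k / 4

  qᵏ≢0 : ℕ.NonZero (q ^ k)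
  qᵏ≢0 = inhabited⇒nonZero (vector-cardinality hF k) (λ _ → Field.0# F)

  2N≤qᵏ : N * 2 ≤ q ^ k
  2N≤qᵏ = ℕ.≤-trans (ℕ.*-monoʳ-≤ N (ℕ.m≤m+n 2 2)) (m/n*n≤m (q ^ k) 4)

  lineCount≤N : ∀ i → lineCount F hF d k E m hE i ≤ N
  lineCount≤N i = begin
    L             ≡⟨ m*n/n≡m L 4 ⟨
    L * 4 / 4     ≡⟨ ≡.cong (_/ 4) (ℕ.*-comm L 4) ⟩
    -- Rounding down is monotone, so `4 * L ≤ q ^ k` bounds `L` by the integer part `N`.
    4 * L / 4     ≤⟨ /-monoˡ-≤ 4 (ℕ.≰⇒≥ (λ large → allSmall (i , large))) ⟩
    N             ∎
    where L = lineCount F hF d k E m hE i
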